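{- For all impartial hypergames $x,y\in\mathcal J$, $$\gamma(x+y)=\gamma(x)\oplus\gamma(y).$$
   Context: Impartial hypergames: work in a universe of possibly non-wellfounded sets (set theory with the Antifoundation Axiom, and the Axiom of Choice). The class $\mathcal J$ of impartial hypergames is the carrier of the final coalgebra of the powerset functor $\mathcal P$ (on classes); so an impartial hypergame $x$ is a possibly non-wellfounded set of impartial hypergames (its options). Equality is bisimilarity of sets. Sum (coinductively): $x+y=\{x'+y\mid x'\in x\}\cup\{x+y'\mid y'\in y\}$. Generalized Grundy numbers: the ordinals and the formal symbols $\infty_K$ for $K\subseteq\mathrm{Ord}$ a set; $\infty$ denotes $\infty_\emptyset$. Generalized Nim sum: for ordinals $\alpha,\beta$, $\alpha\oplus\beta$ is the Nim sum, i.e. binary sum without carries (for infinite ordinals, using base-2 expansions). It is extended by $\alpha\oplus\infty_K=\infty_K\oplus\alpha=\infty_{\{k\oplus\alpha\mid k\in K\}}$ and $\infty_K\oplus\infty_H=\infty$. Generalized Grundy function: $\mathrm{mex}(S)$ is the least ordinal not in the set $S$ of ordinals. Order $\mathrm{Ord}\cup\{\bot\}$ by the flat order with bottom $\bot$, and functions $\mathcal J\to\mathrm{Ord}\cup\{\bot\}$ pointwise. For such $f$ let $\mathcal F_f(x)=\{f(y)\mid y\in x,\ f(y)\ne\bot\}$. Let $D$ be the subspace of those $f$ such that for all $x$, if $f(x)=\alpha\in\mathrm{Ord}$ then $\alpha=\mathrm{mex}(\mathcal F_f(x))$ and for every $y\in x$ with $f(y)=\bot$ there is $z\in y$ with $f(z)=\mathrm{mex}(\mathcal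 F_f(x))$. Define $T:D\to D$ by $T(f)(x)=\mathrm{mex}(\mathcal F_f(x))$ if for every $y\in x$ with $f(y)=\bot$ there is $z\in y$ with $f(z)=\mathrm{mex}(\mathcal F_f(x))$, and $T(f)(x)=\bot$ otherwise. Let $\gamma_0$ be the least fixpoint of $T$, obtained by transfinitely iterating $T$ from the constant function $\bot$. Then $\gamma(x)=\gamma_0(x)$ if $\gamma_0(x)\in\mathrm{Ord}$, and otherwise $\gamma(x)=\infty_K$ with $K=\{\gamma_0(y)\mid y\in x,\ \gamma_0(y)\neq\bot\}$. -}

module Defs where

open import Axiom.ExcludedMiddle using (ExcludedMiddle)
open import Data.Bool.Base using (T)
open import Data.Empty using (⊥-elim)
open import Data.List.Base using (List; []; _∷_; foldr)
open import Data.List.Relation.Unary.Linked using (Linked; []; [-]; _∷_)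
open import Data.Maybe.Base using (Maybe; just; nothing; is-just; maybe′)
open import Data.Maybe.Relation.Unary.Any using (Any; just)
open import Data.Nat.Base using (ℕ; zero; suc)
open import Data.Product using (Σ-syntax; ∃; ∃-syntax; _×_; _,_; proj₁; proj₂)
open import Data.Sum using (_⊎_; inj₁; inj₂; [_,_])
open import Data.Unit using (⊤; tt)
open import Function.Base using (const)
open import Function.Bundles using (_⇔_; mk⇔; Equivalence)
open import Level using (Level; 0ℓ; _⊔_) renaming (suc to lsuc)
open import Relation.Binary.Core using (REL)
open import Relation.Binary.Definitions using (Trichotomous; Tri; tri<; tri≈; tri>)
open import Relation.Binary.PropositionalEquality using (_≡_; refl; sym; subst)
open import Relation.Nullary using (Dec; ¬_; yes; no; contradiction)
open import Relation.Nullary.Decidable using (True; toWitness; fromWitness; decidable-stable)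

private
  variable
    a ℓ : Level

-- Sets of the set theory are rendered by Agda's Set, classes by Set₁.
-- sup f denotes the least ordinal strictly above every f i.  Distinct
-- trees may denote the same ordinal: equality of ordinals is _≈_.

data Ord : Set₁ where
  sup : {I : Set} → (I → Ord) → Ord

Below : Ord → Set
Below (sup {I} _) = I

below : (α : Ord) → Below α → Ord
below (sup f) = f

infix 4 _≤_ _<_ _>_ _≈_

mutual
  _≤_ : Ord → Ord → Set
  sup f ≤ β = ∀ i → f i < β

  _<_ : Ord → Ord → Set
  α < sup g = ∃[ j ] α ≤ g j

_>_ : Ord → Ord → Set
α > β = β < α

_≈_ : Ord → Ord → Set
α ≈ β = α ≤ β × β ≤ α

0ᵒ : Ord
0ᵒ = sup ⊥-elim

-- α + β is the least ordinal that is ≥ α and > α + β′ for all β′ < β.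

infixl 6 _+ᵒ_

_+ᵒ_ : Ord → Ord → Ord
α +ᵒ sup g = sup [ below α , (λ j → α +ᵒ g j) ]

-- 2 ^ β is the least ordinal that is ≥ 1 and ≥ (2 ^ β′) · 2 for all β′ < β.

infix 8 2^_

2^_ : Ord → Ord
2^ sup {I} f = sup {⊤ ⊎ (Σ[ i ∈ I ] Below (2^ f i +ᵒ 2^ f i))}
                   [ const 0ᵒ , (λ (i , k) → below (2^ f i +ᵒ 2^ f i) k) ]

∑2^ : List Ord → Ord
∑2^ = foldr (λ α σ → 2^ α +ᵒ σ) 0ᵒ

-- Sets of ordinals, given as the range of a family.

record OrdSet : Set₁ where
  constructor range
  field
    {Index} : Set
    elem    : Index → Ord

open OrdSet public

infix 4 _∈_ _≐_

_∈_ : Ord → OrdSet → Set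
α ∈ K = ∃[ i ] elem K i ≈ α

_≐_ : OrdSet → OrdSet → Set₁
K ≐ H = ∀ α → α ∈ K ⇔ α ∈ H

∅ : OrdSet
∅ = range ⊥-elim

≤-refl : ∀ {α} → α ≤ α
≤-refl {sup f} i = i , ≤-refl

mutual
  ≤-trans : ∀ {α β γ} → α ≤ β → β ≤ γ → α ≤ γ
  ≤-trans {sup f} p q i = <-≤-trans (p i) q

  <-≤-trans : ∀ {α β γ} → α < β → β ≤ γ → α < γ
  <-≤-trans {β = sup g} (j , p) q = ≤-<-trans p (q j)

  ≤-<-trans : ∀ {α β γ} → α ≤ β → β < γ → α < γ
  ≤-<-trans {γ = sup h} p (k , q) = k , ≤-trans p q

<⇒≤ : ∀ {α β} → α < β → α ≤ β
<⇒≤ {sup f} {sup g} (j , p) i = j , <⇒≤ (p i)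

<-irrefl : ∀ {α} → ¬ α < α
<-irrefl {sup f} (i , p) = <-irrefl (<-≤-trans (p i) ≤-refl)

below-< : ∀ α k → below α k < α
below-< (sup f) k = k , ≤-refl

≈-sym : ∀ {α β} → α ≈ β → β ≈ α
≈-sym (p , q) = q , p

≈-trans : ∀ {α β γ} → α ≈ β → β ≈ γ → α ≈ γ
≈-trans (p , q) (r , s) = ≤-trans p r , ≤-trans s q

mutual
  +-monoʳ-≤ : ∀ α {β γ} → β ≤ γ → α +ᵒ β ≤ α +ᵒ γ
  +-monoʳ-≤ α {sup g} {sup h} p (inj₁ i) = inj₁ i , ≤-refl
  +-monoʳ-≤ α {sup g} {sup h} p (inj₂ j) = +-monoʳ-< α (p j)

  +-monoʳ-< : ∀ α {β γ} → β < γ → α +ᵒ β < α +ᵒ γ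
  +-monoʳ-< α {γ = sup h} (k , p) = inj₂ k , +-monoʳ-≤ α p

+-congʳ : ∀ α {β γ} → β ≈ γ → α +ᵒ β ≈ α +ᵒ γ
+-congʳ α (p , q) = +-monoʳ-≤ α p , +-monoʳ-≤ α q

α≤α+β : ∀ α β → α ≤ α +ᵒ β
α≤α+β (sup f) (sup g) i = inj₁ i , ≤-refl

+-monoˡ-≤ : ∀ {α β} γ → α ≤ β → α +ᵒ γ ≤ β +ᵒ γ
+-monoˡ-≤ {sup f} {β} (sup h) p (inj₁ i) = <-≤-trans (p i) (α≤α+β β (sup h))
+-monoˡ-≤ (sup h) p (inj₂ k) = inj₂ k , +-monoˡ-≤ (h k) p

0<2^ : ∀ α → 0ᵒ < 2^ α
0<2^ (sup f) = inj₁ tt , λ ()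

mutual
  2^-double : ∀ {α β} → α < β → 2^ α +ᵒ 2^ α ≤ 2^ β
  2^-double {α} {sup g} (j , p) =
    ≤-trans (≤-trans (+-monoˡ-≤ (2^ α) (2^-mono-≤ p)) (+-monoʳ-≤ (2^ g j) (2^-mono-≤ p)))
            (children (λ k → inj₂ (j , k) , ≤-refl))
    where
    children : ∀ {α β} → (∀ k → below α k < β) → α ≤ β
    children {sup f} p = p

  2^-mono-≤ : ∀ {α β} → α ≤ β → 2^ α ≤ 2^ β
  2^-mono-≤ {sup f} {β} p (inj₁ tt) = 0<2^ β
  2^-mono-≤ {sup f} {β} p (inj₂ (i , k)) = <-≤-trans (below-< _ k) (2^-double (p i))

2^-mono-< : ∀ {α β} → α < β → 2^ α < 2^ β
2^-mono-< {α} p = <-≤-trans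
  (≤-<-trans (α≤α+β (2^ α) 0ᵒ) (+-monoʳ-< (2^ α) (0<2^ α))) (2^-double p)

α≤2^α : ∀ α → α ≤ 2^ α
α≤2^α (sup f) i = ≤-<-trans (α≤2^α (f i)) (2^-mono-< {β = sup f} (i , ≤-refl))

-- By antifoundation, a possibly non-wellfounded set is given by a small
-- graph with a chosen node, two pointed graphs giving the same set exactly
-- when they are bisimilar.  unfold-morphism and unfold-unique below show that
-- pointed graphs, up to bisimilarity, are the final coalgebra of the powerset
-- functor on classes.

record Hypergame : Set₁ where
  field
    {Node} : Set
    Move   : Node → Set
    target : (n : Node) → Move n → Node
    root   : Node

open Hypergame public

infixl 8 _at_

_at_ : (x : Hypergame) → Node x → Hypergame
x at n = record { Move = Move x ; target = target x ; root = n }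

Option : Hypergame → Set
Option x = Move x (root x)

option : (x : Hypergame) → Option x → Hypergame
option x i = x at target x (root x) i

Match : {I J : Set} → REL I J ℓ → Set ℓ
Match R = (∀ i → ∃[ j ] R i j) × (∀ j → ∃[ i ] R i j)

infix 4 _∼_

_∼_ : Hypergame → Hypergame → Set₁
x ∼ y = Σ[ R ∈ REL (Node x) (Node y) 0ℓ ]
          R (root x) (root y) ×
          (∀ {n m} → R n m → Match λ i j → R (target x n i) (target y m j))

infixl 6 _+_

_+_ : Hypergame → Hypergame → Hypergame
x + y = record
  { Node   = Node x × Node y
  ; Move   = λ (n , m) → Move x n ⊎ Move y m
  ; target = λ (n , m) → [ (λ i → target x n i , m) , (λ j → n , target y m j) ]
  ; root   = root x , root y
  }

option-+ˡ : ∀ x y i → option (x + y) (inj₁ i) ≡ option x i + y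
option-+ˡ x y i = refl

option-+ʳ : ∀ x y j → option (x + y) (inj₂ j) ≡ x + option y j
option-+ʳ x y j = refl

∼-refl : ∀ {x} → x ∼ x
∼-refl = _≡_ , refl , λ { refl → (λ i → i , refl) , (λ i → i , refl) }

∼-sym : ∀ {x y} → x ∼ y → y ∼ x
∼-sym (R , r , b) = (λ m n → R n m) , r , λ p → proj₂ (b p) , proj₁ (b p)

∼-trans : ∀ {x y z} → x ∼ y → y ∼ z → x ∼ z
∼-trans (R , r , b) (S , s , c) =
  (λ n k → ∃[ m ] R n m × S m k) , (_ , r , s) , λ (_ , p , q) →
    (λ i → let j , p′ = proj₁ (b p) i
               k , q′ = proj₁ (c q) j in k , _ , p′ , q′) ,
    (λ k → let j , q′ = proj₂ (c q) k
               i , p′ = proj₂ (b p) j in i , _ , p′ , q′)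

∼-options : ∀ {x y} → x ∼ y → Match λ i j → option x i ∼ option y j
∼-options (R , r , b) =
  (λ i → let j , p = proj₁ (b r) i in j , R , p , b) ,
  (λ j → let i , p = proj₂ (b r) j in i , R , p , b)

data Grundy : Set₁ where
  ord  : Ord → Grundy
  ∞[_] : OrdSet → Grundy

∞ : Grundy
∞ = ∞[ ∅ ]

infix 4 _≃_

data _≃_ : Grundy → Grundy → Set₁ where
  ord  : ∀ {α β} → α ≈ β → ord α ≃ ord β
  ∞[_] : ∀ {K H} → K ≐ H → ∞[ K ] ≃ ∞[ H ]

-- Functions from hypergames to Ord ∪ {⊥}, with nothing for ⊥.

Labelling : Set₁
Labelling = Hypergame → Maybe Ord

infix 4 _↦_ _⊑_

_↦_ : Maybe Ord → Ord → Set₁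
m ↦ α = Any (_≈ α) m

_⊑_ : Labelling → Labelling → Set₁
f ⊑ g = ∀ x {α} → f x ↦ α → g x ↦ α

-- Tested by T ∘ is-just rather than Is-just so that labels f x is indexed
-- by a Set.

value : (m : Maybe Ord) → T (is-just m) → Ord
value (just α) _ = α

labels : Labelling → Hypergame → OrdSet
labels f x = range {Index = Σ[ i ∈ Option x ] T (is-just (f (option x i)))}
                   (λ (i , p) → value (f (option x i)) p)

Reverts : Labelling → Hypergame → Ord → Set₁
Reverts f x α = ∀ i → f (option x i) ≡ nothing →
                ∃[ j ] f (option (option x i) j) ↦ α

-- The ambient set theory is classical, which excluded middle provides.

module Classical (em : ∀ {ℓ} → ExcludedMiddle ℓ) where

  mutual
    ≰⇒> : ∀ {α β} → ¬ α ≤ β → β < α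
    ≰⇒> {sup f} {β} p with em {P = ∃[ i ] ¬ f i < β}
    ... | yes (i , q) = i , ≮⇒≥ q
    ... | no q = contradiction (λ i → decidable-stable em λ r → q (i , r)) p

    ≮⇒≥ : ∀ {α β} → ¬ α < β → β ≤ α
    ≮⇒≥ {β = sup g} p j = ≰⇒> λ q → p (j , q)

  compare : Trichotomous _≈_ _<_
  compare α β with em {P = α ≤ β} | em {P = β ≤ α}
  ... | yes p | yes q = tri≈ (λ r → <-irrefl (<-≤-trans r q)) (p , q)
                             (λ r → <-irrefl (<-≤-trans r p))
  ... | yes p | no q  = tri< (≰⇒> q) (λ r → q (proj₂ r)) (λ r → q (<⇒≤ r))
  ... | no p  | _     = tri> (λ r → p (<⇒≤ r)) (λ r → p (proj₁ r)) (≰⇒> p)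

  least : (P : Ord → Set ℓ) → ∃ P → ∃[ μ ] P μ × (∀ {α} → α < μ → ¬ P α)
  least P (α , p) = search α (α , ≤-refl , p)
    where
    search : ∀ β → ∃[ α ] α ≤ β × P α → ∃[ μ ] P μ × (∀ {α} → α < μ → ¬ P α)
    search (sup g) (α , α≤β , p) with em {P = ∃[ j ] ∃[ α′ ] α′ ≤ g j × P α′}
    ... | yes (j , w) = search (g j) w
    ... | no  none    = α , p , λ α′<α p′ →
      let j , α′≤gj = <-≤-trans α′<α α≤β in none (j , _ , α′≤gj , p′)

  outside : ∀ K → ∃[ α ] ¬ α ∈ K
  outside K = sup (elem K) , λ (i , _ , p) → <-irrefl (p i)

  mex : OrdSet → Ord
  mex K = proj₁ (least (λ α → ¬ α ∈ K) (outside K))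

  Expansion : Ord → Set₁
  Expansion α = Σ[ αs ∈ List Ord ] Linked _>_ αs × α ≈ ∑2^ αs

  leading : ∀ α → 0ᵒ < α → ∃[ ε ] ∃[ ρ ] 2^ ε ≤ α × ρ < 2^ ε × α ≈ 2^ ε +ᵒ ρ
  leading α 0<α with least (λ δ → α < 2^ δ) (sup {⊤} (const α) , α<2^[1+α])
    where
    α<2^[1+α] = ≤-<-trans (α≤2^α α) (2^-mono-< {β = sup (const α)} (tt , ≤-refl))
  ... | sup f , (inj₁ tt , α≤0) , min = contradiction (<-≤-trans 0<α α≤0) <-irrefl
  ... | sup f , (inj₂ (i , k) , α≤) , min with
                                            least (λ ρ → α ≤ 2^ f i +ᵒ ρ) (α , α≤β+α (2^ f i) α)
    where
    α≤β+α : ∀ β α → α ≤ β +ᵒ α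
    α≤β+α β (sup f) i = inj₂ i , α≤β+α β (f i)
  ... | ρ , α≤2^ε+ρ , minρ = f i , ρ , 2^ε≤α , ρ<2^ε , α≤2^ε+ρ , bound ρ minρ
    where
    2^ε≤α : 2^ f i ≤ α
    2^ε≤α = ≮⇒≥ (min (i , ≤-refl))

    bound : ∀ ρ → (∀ {β} → β < ρ → ¬ α ≤ 2^ f i +ᵒ β) → 2^ f i +ᵒ ρ ≤ α
    bound (sup g) minρ (inj₁ k) = <-≤-trans (below-< _ k) 2^ε≤α
    bound (sup g) minρ (inj₂ j) = ≰⇒> (minρ (j , ≤-refl))

    ρ<2^ε : ρ < 2^ f i
    ρ<2^ε = ≰⇒> λ 2^ε≤ρ → <-irrefl
      (<-≤-trans (≤-<-trans α≤ (below-< _ k))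
                 (≤-trans (+-monoʳ-≤ (2^ f i) 2^ε≤ρ) (bound ρ minρ)))

  expansion : ∀ α → Expansion α
  expansion α = expand (sup {⊤} (const α)) α (tt , ≤-refl)
    where
    expand : ∀ β α → α < β → Expansion α
    expand (sup g) α (j , α≤gj) with em {P = α ≤ 0ᵒ}
    ... | yes α≤0 = [] , [] , α≤0 , λ ()
    ... | no  α≰0 with leading α (≰⇒> α≰0)
    ... | ε , ρ , 2^ε≤α , ρ<2^ε , α≈
      with expand (g j) ρ (<-≤-trans ρ<2^ε (≤-trans 2^ε≤α α≤gj))
    ... | []     , _   , ρ≈ = ε ∷ [] , [-] , ≈-trans α≈ (+-congʳ _ ρ≈)
    ... | δ ∷ δs , lnk , ρ≈ = ε ∷ δ ∷ δs , δ<ε ∷ lnk , ≈-trans α≈ (+-congʳ _ ρ≈)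
      where
      δ<ε : δ < ε
      δ<ε = ≰⇒> λ ε≤δ → <-irrefl
        (<-≤-trans ρ<2^ε (≤-trans (2^-mono-≤ ε≤δ) (≤-trans (α≤α+β _ _) (proj₂ ρ≈))))

  exponents : Ord → List Ord
  exponents α = proj₁ (expansion α)

  -- Addition without carries of base-2 expansions, given by their exponents
  -- in decreasing order.

  byOrder : {A B C : Set} {X : Set ℓ} → Tri A B C → X → X → X → X
  byOrder (tri< _ _ _) x y z = x
  byOrder (tri≈ _ _ _) x y z = y
  byOrder (tri> _ _ _) x y z = z

  xor : List Ord → List Ord → List Ord
  xor []       βs       = βs
  xor (α ∷ αs) []       = α ∷ αs
  xor (α ∷ αs) (β ∷ βs) =
    byOrder (compare α β) (β ∷ xor (α ∷ αs) βs)   -- α < β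
                          (xor αs βs)             -- α ≈ β
                          (α ∷ xor αs (β ∷ βs))   -- α > β

  infixl 6 _⊕ᵒ_ _⊕_

  _⊕ᵒ_ : Ord → Ord → Ord
  α ⊕ᵒ β = ∑2^ (xor (exponents α) (exponents β))

  _⊕_ : Grundy → Grundy → Grundy
  ord α  ⊕ ord β  = ord (α ⊕ᵒ β)
  ord α  ⊕ ∞[ K ] = ∞[ range (λ k → elem K k ⊕ᵒ α) ]
  ∞[ K ] ⊕ ord α  = ∞[ range (λ k → elem K k ⊕ᵒ α) ]
  ∞[ _ ] ⊕ ∞[ _ ] = ∞

  -- 𝓣 is defined on all labellings; 𝓣-D below shows that it restricts to D.

  record D (f : Labelling) : Set₁ where
    field
      respects-∼ : ∀ {x y α} → x ∼ y → f x ↦ α → f y ↦ α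
      mex-rule   : ∀ {x α} → f x ↦ α →
                   α ≈ mex (labels f x) × Reverts f x (mex (labels f x))

  _when_ : {P : Set ℓ} → Ord → Dec P → Maybe Ord
  α when yes _ = just α
  α when no _  = nothing

  𝓣 : Labelling → Labelling
  𝓣 f x = mex (labels f x) when em {P = Reverts f x (mex (labels f x))}

  some : {I : Set ℓ} {m : I → Maybe Ord} → Dec (∃[ i ] ∃[ α ] m i ≡ just α) → Maybe Ord
  some (yes (_ , α , _)) = just α
  some (no _)            = nothing

  -- Pointwise supremum, for a family whose values at each hypergame are
  -- pairwise compatible in the flat order.
  ⨆ : {I : Set ℓ} → (I → Labelling) → Labelling
  ⨆ F x = some (em {P = ∃[ i ] ∃[ α ] F i x ≡ just α})

  -- stage α = ⨆_{β < α} 𝓣 (stage β); in particular stage 0 is constantly ⊥.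
  stage : Ord → Labelling
  stage (sup f) = ⨆ λ i → 𝓣 (stage (f i))

  γ₀ : Labelling
  γ₀ = ⨆ stage

  γ : Hypergame → Grundy
  γ x = maybe′ ord ∞[ labels γ₀ x ] (γ₀ x)

  -- Hypergame, up to bisimilarity, is the final coalgebra.

  coinduction : (R : Hypergame → Hypergame → Set ℓ) →
                (∀ {x y} → R x y → Match λ i j → R (option x i) (option y j)) →
                ∀ {x y} → R x y → x ∼ y
  coinduction R step {x} {y} r =
    (λ n m → True (em {P = R (x at n) (y at m)})) , fromWitness r , λ p →
      let forth , back = step (toWitness p) in
      (λ i → let j , q = forth i in j , fromWitness q) ,
      (λ j → let i , q = back j in i , fromWitness q)

  -- The coalgebra sends x to the set { opt x i ∣ i : Idx x }.
  module _ {X : Set₁} (Idx : X → Set) (opt : ∀ x → Idx x → X) where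

    IsMorphism : (X → Hypergame) → Set₁
    IsMorphism h = ∀ x → Match λ i j → h (opt x i) ∼ option (h x) j

    Path : ℕ → X → Set
    Path zero    x = ⊤
    Path (suc n) x = Σ[ i ∈ Idx x ] Path n (opt x i)

    end : ∀ n {x} → Path n x → X
    end zero    {x} _       = x
    end (suc n)     (_ , p) = end n p

    snoc : ∀ n {x} (p : Path n x) → Idx (end n p) → Path (suc n) x
    snoc zero    _       k = k , tt
    snoc (suc n) (i , p) k = i , snoc n p k

    unfold : X → Hypergame
    unfold x = record
      { Node   = ∃[ n ] Path n x
      ; Move   = λ (n , p) → Idx (end n p)
      ; target = λ (n , p) k → suc n , snoc n p k
      ; root   = zero , tt
      }

    unfold-morphism : IsMorphism unfold
    unfold-morphism x = (λ i → i , shift i) , (λ i → i , shift i)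
      where
      shift : ∀ i → unfold (opt x i) ∼ option (unfold x) i
      shift i = (λ (n , p) m → (suc n , i , p) ≡ m) , refl ,
                λ { refl → (λ k → k , refl) , (λ k → k , refl) }

    unfold-unique : ∀ {h h′} → IsMorphism h → IsMorphism h′ → ∀ x → h x ∼ h′ x
    unfold-unique {h} {h′} m m′ x = coinduction (λ a b → ∃[ z ] a ∼ h z × b ∼ h′ z)
      (λ { (z , p , q) →
        (λ i → let j , p′ = proj₁ (∼-options p) i
                   l , r  = proj₂ (m z) j
                   k , r′ = proj₁ (m′ z) l
                   o , q′ = proj₂ (∼-options q) k
               in o , opt z l , ∼-trans p′ (∼-sym r) , ∼-trans q′ (∼-sym r′)) ,
        (λ o → let k , q′ = proj₁ (∼-options q) o
                   l , r′ = proj₂ (m′ z) k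
                   j , r  = proj₁ (m z) l
                   i , p′ = proj₂ (∼-options p) j
               in i , opt z l , ∼-trans p′ (∼-sym r) , ∼-trans q′ (∼-sym r′)) })
      (x , ∼-refl , ∼-refl)

  -- γ₀ is the least fixpoint of 𝓣 on D; in particular it respects bisimilarity.

  ∈-resp-≈ : ∀ K {α β} → α ≈ β → α ∈ K → β ∈ K
  ∈-resp-≈ K p (i , q) = i , ≈-trans q p

  ↦-resp-≈ : ∀ {m α β} → α ≈ β → m ↦ α → m ↦ β
  ↦-resp-≈ p (just q) = just (≈-trans q p)

  ↦-unique : ∀ {m α β} → m ↦ α → m ↦ β → α ≈ β
  ↦-unique (just p) (just q) = ≈-trans (≈-sym p) q

  mex-∉ : ∀ K → ¬ mex K ∈ K
  mex-∉ K = proj₁ (proj₂ (least (λ α → ¬ α ∈ K) (outside K)))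

  <mex⇒∈ : ∀ K {α} → α < mex K → α ∈ K
  <mex⇒∈ K p = decidable-stable em
    (proj₂ (proj₂ (least (λ α → ¬ α ∈ K) (outside K))) p)

  mex-unique : ∀ K {α} → ¬ α ∈ K → (∀ {β} → β < α → β ∈ K) → α ≈ mex K
  mex-unique K α∉ <α⇒∈ = ≮⇒≥ (λ p → mex-∉ K (<α⇒∈ p)) , ≮⇒≥ (λ p → α∉ (<mex⇒∈ K p))

  mex-cong : ∀ {K H} → K ≐ H → mex K ≈ mex H
  mex-cong {K} {H} e = mex-unique H
    (λ p → mex-∉ K (Equivalence.from (e _) p))
    (λ p → Equivalence.to (e _) (<mex⇒∈ K p))

  ∈-labels⁻ : ∀ f x {α} → α ∈ labels f x → ∃[ i ] f (option x i) ↦ α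
  ∈-labels⁻ f x ((i , p) , q) with f (option x i) in eq
  ... | just β = i , subst (_↦ _) (sym eq) (just q)

  ∈-labels⁺ : ∀ f x {α} i → f (option x i) ↦ α → α ∈ labels f x
  ∈-labels⁺ f x i p = (i , proj₁ (split p)) , proj₂ (split p)
    where
    split : ∀ {m α} → m ↦ α → Σ[ t ∈ T (is-just m) ] value m t ≈ α
    split (just p) = tt , p

  ⊥-or-↦ : ∀ m → m ≡ nothing ⊎ ∃[ α ] m ↦ α
  ⊥-or-↦ nothing  = inj₁ refl
  ⊥-or-↦ (just α) = inj₂ (α , just (≤-refl , ≤-refl))

  ↦⇒≢⊥ : ∀ {m α} → m ↦ α → ¬ m ≡ nothing
  ↦⇒≢⊥ (just _) ()

  Reverts-resp-≈ : ∀ f x {α β} → α ≈ β → Reverts f x α → Reverts f x β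
  Reverts-resp-≈ f x p r i eq = let j , q = r i eq in j , ↦-resp-≈ p q

  𝓣⁻ : ∀ f x {α} → 𝓣 f x ↦ α → mex (labels f x) ≈ α × Reverts f x (mex (labels f x))
  𝓣⁻ f x p with em {P = Reverts f x (mex (labels f x))}
  𝓣⁻ f x (just p) | yes r = p , r

  𝓣⁺ : ∀ f x → Reverts f x (mex (labels f x)) → 𝓣 f x ↦ mex (labels f x)
  𝓣⁺ f x r with em {P = Reverts f x (mex (labels f x))}
  ... | yes _ = just (≤-refl , ≤-refl)
  ... | no ¬r = contradiction r ¬r

  Consistent : Labelling → Set₁
  Consistent f = ∀ x i {α} → f x ↦ α → ¬ f (option x i) ↦ α

  D⇒consistent : ∀ {f} → D f → Consistent f
  D⇒consistent {f} d x i p q =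
    mex-∉ _ (∈-labels⁺ f x i (↦-resp-≈ (proj₁ (D.mex-rule d p)) q))

  mex-mono : ∀ {f g} → f ⊑ g → Consistent g → ∀ x →
             Reverts f x (mex (labels f x)) →
             mex (labels f x) ≈ mex (labels g x) × Reverts g x (mex (labels g x))
  mex-mono {f} {g} f⊑g con x r = eq , Reverts-resp-≈ g x eq rev
    where
    μ = mex (labels f x)

    ∉ : ∀ i → ¬ g (option x i) ↦ μ
    ∉ i p with ⊥-or-↦ (f (option x i))
    ... | inj₁ e = let j , q = r i e in con _ j p (f⊑g _ q)
    ... | inj₂ (β , q) = mex-∉ (labels f x)
      (∈-labels⁺ f x i (↦-resp-≈ (↦-unique (f⊑g _ q) p) q))

    eq : μ ≈ mex (labels g x)
    eq = mex-unique (labels g x)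
      (λ p → let i , q = ∈-labels⁻ g x p in ∉ i q)
      (λ p → let i , q = ∈-labels⁻ f x (<mex⇒∈ _ p) in ∈-labels⁺ g x i (f⊑g _ q))

    rev : Reverts g x μ
    rev i e with ⊥-or-↦ (f (option x i))
    ... | inj₁ e′ = let j , q = r i e′ in j , f⊑g _ q
    ... | inj₂ (β , q) = contradiction e (↦⇒≢⊥ (f⊑g _ q))

  𝓣-mono : ∀ {f g} → f ⊑ g → D g → 𝓣 f ⊑ 𝓣 g
  𝓣-mono {f} {g} f⊑g d x p =
    let e , r  = 𝓣⁻ f x p
        e′ , s = mex-mono f⊑g (D⇒consistent d) x r
    in ↦-resp-≈ (≈-trans (≈-sym e′) e) (𝓣⁺ g x s)

  D⇒⊑𝓣 : ∀ {f} → D f → f ⊑ 𝓣 f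
  D⇒⊑𝓣 {f} d x p = let e , r = D.mex-rule d p in ↦-resp-≈ (≈-sym e) (𝓣⁺ f x r)

  𝓣-D : ∀ {f} → D f → D (𝓣 f)
  𝓣-D {f} d = record
    { respects-∼ = λ {x} {y} x∼y p →
        let e , r = 𝓣⁻ f x p
            μ≈ = mex-cong (labels-cong x∼y)
        in ↦-resp-≈ (≈-trans (≈-sym μ≈) e)
             (𝓣⁺ f y (Reverts-resp-≈ f y μ≈ (transport x∼y r)))
    ; mex-rule = λ {x} p →
        let e , r = 𝓣⁻ f x p
            e′ , s = mex-mono (D⇒⊑𝓣 d) con x r
        in ≈-trans (≈-sym e) e′ , s
    }
    where
    open D d

    con : Consistent (𝓣 f)
    con x i p q with ⊥-or-↦ (f (option x i)) | 𝓣⁻ f x p | 𝓣⁻ f (option x i) q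
    ... | inj₁ eq | e , r | e′ , _ = let j , s = r i eq in
      mex-∉ _ (∈-labels⁺ f _ j (↦-resp-≈ (≈-trans e (≈-sym e′)) s))
    ... | inj₂ (β , s) | e , r | e′ , _ =
      mex-∉ _ (∈-labels⁺ f x i (↦-resp-≈
        (≈-trans (proj₁ (mex-rule s)) (≈-trans e′ (≈-sym e))) s))

    labels-⊆ : ∀ {x y} → x ∼ y → ∀ {α} → α ∈ labels f x → α ∈ labels f y
    labels-⊆ {x} {y} x∼y p =
      let i , q = ∈-labels⁻ f x p
          j , s = proj₁ (∼-options x∼y) i
      in ∈-labels⁺ f y j (respects-∼ s q)

    labels-cong : ∀ {x y} → x ∼ y → labels f x ≐ labels f y
    labels-cong x∼y α = mk⇔ (labels-⊆ x∼y) (labels-⊆ (∼-sym x∼y))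

    transport : ∀ {x y α} → x ∼ y → Reverts f x α → Reverts f y α
    transport {x} {y} x∼y r j e with proj₂ (∼-options x∼y) j
    ... | i , s with ⊥-or-↦ (f (option x i))
    ... | inj₁ e′ = let k , q = r i e′
                        l , t = proj₁ (∼-options s) k
                    in l , respects-∼ t q
    ... | inj₂ (_ , q) = contradiction e (↦⇒≢⊥ (respects-∼ s q))

  module _ {I : Set ℓ} (F : I → Labelling) where

    Directed : Set (ℓ ⊔ lsuc 0ℓ)
    Directed = ∀ i j → F i ⊑ F j ⊎ F j ⊑ F i

    ⨆⁻ : ∀ x {α} → ⨆ F x ↦ α → ∃[ i ] F i x ↦ α
    ⨆⁻ x p with em {P = ∃[ i ] ∃[ α ] F i x ≡ just α}
    ⨆⁻ x (just p) | yes (i , β , e) = i , subst (_↦ _) (sym e) (just p)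

    ⨆⁺ : Directed → ∀ i → F i ⊑ ⨆ F
    ⨆⁺ dir i x p with em {P = ∃[ i ] ∃[ α ] F i x ≡ just α}
    ... | no none = contradiction p λ p → none (i , defined p)
      where
      defined : ∀ {m α} → m ↦ α → ∃[ β ] m ≡ just β
      defined (just _) = _ , refl
    ... | yes (j , β , e) with dir i j
    ...   | inj₁ q = just (↦-unique (subst (_↦ β) (sym e) (just (≤-refl , ≤-refl))) (q x p))
    ...   | inj₂ q = just (↦-unique (q x (subst (_↦ β) (sym e) (just (≤-refl , ≤-refl)))) p)

    ⨆-D : Directed → (∀ i → D (F i)) → D (⨆ F)
    ⨆-D dir d = record
      { respects-∼ = λ x∼y p → let i , q = ⨆⁻ _ p in
          ⨆⁺ dir i _ (D.respects-∼ (d i) x∼y q)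
      ; mex-rule = λ {x} p →
          let i , q = ⨆⁻ x p
              e , r = D.mex-rule (d i) q
              e′ , s = mex-mono (⨆⁺ dir i) con x r
          in ≈-trans e e′ , s
      }
      where
      con : Consistent (⨆ F)
      con x k p q with ⨆⁻ x p | ⨆⁻ _ q
      ... | i , p′ | j , q′ with dir i j
      ...   | inj₁ l = D⇒consistent (d j) x k (l x p′) q′
      ...   | inj₂ l = D⇒consistent (d i) x k p′ (l _ q′)

  ≤-total : ∀ α β → α ≤ β ⊎ β ≤ α
  ≤-total α β with em {P = α ≤ β}
  ... | yes p = inj₁ p
  ... | no  p = inj₂ (<⇒≤ (≰⇒> p))

  successors : {I : Set} → (I → Ord) → I → Labelling
  successors f i = 𝓣 (stage (f i))

  mutual
    stage-D : ∀ α → D (stage α)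
    stage-D (sup f) = ⨆-D (successors f) (stage-directed f) λ i → 𝓣-D (stage-D (f i))

    stage-directed : ∀ {I} (f : I → Ord) → Directed (successors f)
    stage-directed f i j with ≤-total (f i) (f j)
    ... | inj₁ p = inj₁ (𝓣-mono (stage-mono (f i) (f j) p) (stage-D (f j)))
    ... | inj₂ p = inj₂ (𝓣-mono (stage-mono (f j) (f i) p) (stage-D (f i)))

    stage-mono : ∀ α β → α ≤ β → stage α ⊑ stage β
    stage-mono (sup f) (sup g) p x q =
      let i , r = ⨆⁻ (successors f) x q
          j , s = p i
      in ⨆⁺ (successors g) (stage-directed g) j x
           (𝓣-mono (stage-mono (f i) (g j) s) (stage-D (g j)) x r)

  stages-directed : Directed stage
  stages-directed α β with ≤-total α β
  ... | inj₁ p = inj₁ (stage-mono α β p)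
  ... | inj₂ p = inj₂ (stage-mono β α p)

  γ₀-D : D γ₀
  γ₀-D = ⨆-D stage stages-directed stage-D

  -- 𝓣 f x depends only on f at the options of x and their options.
  𝓣-local : ∀ {f g x} → f ⊑ g →
            (∀ i {α} → g (option x i) ↦ α → f (option x i) ↦ α) →
            (∀ i j {α} → g (option (option x i) j) ↦ α → f (option (option x i) j) ↦ α) →
            ∀ {α} → 𝓣 g x ↦ α → 𝓣 f x ↦ α
  𝓣-local {f} {g} {x} f⊑g g⊑f g⊑f² p =
    let e , r = 𝓣⁻ g x p in ↦-resp-≈ (≈-trans μ≈ e) (𝓣⁺ f x (rev r))
    where
    μ≈ : mex (labels f x) ≈ mex (labels g x)
    μ≈ = mex-cong λ α → mk⇔
      (λ q → let i , r = ∈-labels⁻ f x q in ∈-labels⁺ g x i (f⊑g _ r))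
      (λ q → let i , r = ∈-labels⁻ g x q in ∈-labels⁺ f x i (g⊑f i r))

    rev : Reverts g x (mex (labels g x)) → Reverts f x (mex (labels f x))
    rev r i e with ⊥-or-↦ (g (option x i))
    ... | inj₁ e′      = let j , q = r i e′ in j , ↦-resp-≈ (≈-sym μ≈) (g⊑f² i j q)
    ... | inj₂ (_ , q) = contradiction e (↦⇒≢⊥ (g⊑f i q))

  stage⊑γ₀ : ∀ δ → stage δ ⊑ γ₀
  stage⊑γ₀ = ⨆⁺ stage stages-directed

  born : ∀ y → ∃[ δ ] (∀ {α} → γ₀ y ↦ α → stage δ y ↦ α)
  born y with ⊥-or-↦ (γ₀ y)
  ... | inj₁ e       = 0ᵒ , λ q → contradiction e (↦⇒≢⊥ q)
  ... | inj₂ (α , q) = let δ , r = ⨆⁻ stage y q in δ , λ s → ↦-resp-≈ (↦-unique q s) r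

  all-born : ∀ {I} (y : I → Hypergame) →
             ∃[ δ ] (∀ i {α} → γ₀ (y i) ↦ α → stage δ (y i) ↦ α)
  all-born y = sup (λ i → proj₁ (born (y i))) , λ i q →
    stage-mono (proj₁ (born (y i))) (sup (λ i → proj₁ (born (y i))))
      (<⇒≤ (i , ≤-refl)) (y i) (proj₂ (born (y i)) q)

  𝓣γ₀⊑γ₀ : 𝓣 γ₀ ⊑ γ₀
  𝓣γ₀⊑γ₀ x p with all-born {Option x ⊎ (Σ[ i ∈ Option x ] Option (option x i))}
                           [ option x , (λ (i , j) → option (option x i) j) ]
  ... | δ , q = stage⊑γ₀ (sup {⊤} (const δ)) x
    (⨆⁺ (successors {⊤} (const δ)) (stage-directed {⊤} (const δ)) tt x
      (𝓣-local {f = stage δ} {g = γ₀} {x = x} (stage⊑γ₀ δ)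
        (λ i → q (inj₁ i)) (λ i j → q (inj₂ (i , j))) p))

  γ₀-fixpoint : 𝓣 γ₀ ⊑ γ₀ × γ₀ ⊑ 𝓣 γ₀
  γ₀-fixpoint = 𝓣γ₀⊑γ₀ , D⇒⊑𝓣 γ₀-D

  γ₀-least : ∀ {g} → D g → 𝓣 g ⊑ g → γ₀ ⊑ g
  γ₀-least {g} d 𝓣g⊑g x p = let δ , q = ⨆⁻ stage x p in stage⊑ δ x q
    where
    stage⊑ : ∀ δ → stage δ ⊑ g
    stage⊑ (sup f) x q = let i , r = ⨆⁻ (successors f) x q in
      𝓣g⊑g x (𝓣-mono (stage⊑ (f i)) d x r)

{-# OPTIONS --safe #-}
module Submission where

-- Two facts carry the theorem: γ₀ sends a sum of labelled games to the Nim
-- sum of their labels (γ₀-+), and a sum is labelled only if both summands are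
-- (γ₀-splits).  They determine the labels of the options of x + y as well,
-- hence the value of x + y in the cases where it is some ∞[ K ].
--
-- The arithmetic comes first.  Every ordinal is known by its binary digits:
-- two ordinals compare as their digits do at the highest exponent where they
-- differ (compare-expansions), and the digits of a Nim sum are the exclusive
-- ors of the digits (bit-⊕).  So ⊕ᵒ respects ≈, is commutative and
-- cancellative, and satisfies the property that makes Nim work (<-⊕): an
-- ordinal below α ⊕ᵒ β arises from α ⊕ᵒ β by lowering α or lowering β.
-- Cancellation and <-⊕ say that α ⊕ᵒ β is the least ordinal different from
-- all α′ ⊕ᵒ β and α ⊕ᵒ β′ with α′ < α and β′ < β.
--
-- For γ₀-+, let x and y receive the labels α and β at some stages.  Every
-- option of x either has an earlier label different from α or has an option
-- whose earlier label is α; likewise for y.  By induction on the two stages,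
-- every option of x + y either has a label different from α ⊕ᵒ β or can be
-- answered by a move to label α ⊕ᵒ β, and by <-⊕ all smaller labels are
-- attained.  This is what 𝓣 asks of x + y.
--
-- For γ₀-splits, suppose that x + y gets the label η at some stage although x
-- has none, and let μ be the mex of the labels of the options of x.  Some
-- option x′ has no label, and none of its options is labelled μ.  By induction
-- the earlier stage labels only sums of labelled games, so x′ + y has no label
-- there and must be answered by a move to η, which can only lead to x″ + y
-- with y labelled, say by β, and x″ labelled by some α ≠ μ with α ⊕ᵒ β = η.
-- If α < μ then some option of x is labelled α, which gives x + y an option
-- with its own label η.  If α > μ then μ ⊕ᵒ β is not η; it is not below η,
-- since no option of x is labelled μ; and if it is above η then η = μ ⊕ᵒ β′
-- for some β′ < β, so that the move to an option y′ of y with label β′ must be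
-- answered by a move from x + y′ to label μ ⊕ᵒ β′, and again some option of x
-- would be labelled μ.  All cases are impossible.

open import Defs
open import Axiom.ExcludedMiddle using (ExcludedMiddle)
open import Data.Bool.Base using (Bool; true; false) renaming (_xor_ to _⊻_)
open import Data.Bool.Properties using (xor-comm; xor-assoc; xor-same; xor-identityʳ)
open import Data.Empty using (⊥)
open import Data.List.Base using (List; []; _∷_)
open import Data.List.Relation.Unary.Linked using (Linked; []; [-]; _∷_; tail)
open import Data.Maybe.Base using (Maybe; just; nothing; maybe′)
open import Data.Maybe.Relation.Unary.Any using (just)
open import Data.Product using (∃-syntax; _×_; _,_; proj₁; proj₂)
open import Data.Sum using (_⊎_; inj₁; inj₂; [_,_])
open import Data.Unit using (⊤; tt)
open import Function.Base using (const)
open import Function.Bundles using (mk⇔; Equivalence)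
open import Relation.Binary.Definitions using (Tri; tri<; tri≈; tri>)
open import Relation.Binary.PropositionalEquality
  using (_≡_; refl; sym; trans; cong; cong₂; module ≡-Reasoning)
open import Relation.Nullary using (¬_; contradiction; does; decidable-stable)
open import Relation.Nullary.Decidable using (dec-true; dec-false; does-⇔)

private
  variable
    α β δ η : Ord
    αs βs : List Ord

≈-refl : α ≈ α
≈-refl = ≤-refl , ≤-refl

<-trans : α < β → β < δ → α < δ
<-trans p q = <-≤-trans p (<⇒≤ q)

<⇒≉ : α < β → ¬ α ≈ β
<⇒≉ p (_ , q) = <-irrefl (<-≤-trans p q)

-- Base-2 expansions

Descending : List Ord → Set₁
Descending = Linked _>_

raise-bound : α ≤ β → Descending (α ∷ αs) → Descending (β ∷ αs)
raise-bound p [-]     = [-]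
raise-bound p (q ∷ l) = <-≤-trans q p ∷ l

drop-second : Descending (η ∷ α ∷ αs) → Descending (η ∷ αs)
drop-second (p ∷ l) = raise-bound (<⇒≤ p) l

-- Doubling absorbs the tail: each smaller power is at most half of the next.
∑2^<2^ : Descending (η ∷ αs) → ∑2^ αs < 2^ η
∑2^<2^ {η} [-] = 0<2^ η
∑2^<2^ (p ∷ l) = <-≤-trans (+-monoʳ-< _ (∑2^<2^ l)) (2^-double p)

2^≤∑2^ : ∀ α αs → 2^ α ≤ ∑2^ (α ∷ αs)
2^≤∑2^ α αs = α≤α+β (2^ α) (∑2^ αs)

-- An exponent never exceeds its own power of 2.
bounded-by : ∑2^ αs < η → Descending αs → Descending (η ∷ αs)
bounded-by {[]}     p l = [-]
bounded-by {α ∷ αs} p l = ≤-<-trans (≤-trans (α≤2^α α) (2^≤∑2^ α αs)) p ∷ l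

common-bound : Descending αs → Descending βs →
               ∃[ ε ] Descending (ε ∷ αs) × Descending (ε ∷ βs)
common-bound {αs} {βs} l m = sup {⊤ ⊎ ⊤} [ const (∑2^ αs) , const (∑2^ βs) ] ,
  bounded-by (inj₁ tt , ≤-refl) l , bounded-by (inj₂ tt , ≤-refl) m

module Summation (em : ∀ {ℓ} → ExcludedMiddle ℓ) where
  open Classical em

  -- Binary digits

  [_≈?_] : Ord → Ord → Bool
  [ α ≈? ε ] = does (em {P = α ≈ ε})

  -- The digit at ε of the expansion, as the parity of the number of occurrences
  -- of ε.  Counting mod 2 makes parity-xor hold for arbitrary lists.
  parity : List Ord → Ord → Bool
  parity []       ε = false
  parity (α ∷ αs) ε = [ α ≈? ε ] ⊻ parity αs ε

  ≈?-congˡ : α ≈ β → ∀ ε → [ α ≈? ε ] ≡ [ β ≈? ε ]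
  ≈?-congˡ p ε = does-⇔ (mk⇔ (≈-trans (≈-sym p)) (≈-trans p)) em em

  ⊻-cancelʳ : ∀ a b → (a ⊻ b) ⊻ b ≡ a
  ⊻-cancelʳ a b = trans (xor-assoc a b b) (trans (cong (a ⊻_) (xor-same b)) (xor-identityʳ a))

  ⊻-swap : ∀ a b c → b ⊻ (a ⊻ c) ≡ a ⊻ (b ⊻ c)
  ⊻-swap a b c = trans (sym (xor-assoc b a c))
                   (trans (cong (_⊻ c) (xor-comm b a)) (xor-assoc a b c))

  -- Dropping a common leading exponent is harmless, since two equal digits have
  -- exclusive or zero; otherwise xor only changes the order of the exponents.
  parity-xor : ∀ αs βs ε → parity (xor αs βs) ε ≡ parity αs ε ⊻ parity βs ε
  parity-xor []       βs       ε = refl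
  parity-xor (α ∷ αs) []       ε = sym (xor-identityʳ _)
  parity-xor (α ∷ αs) (β ∷ βs) ε =
    by (compare α β) (parity-xor (α ∷ αs) βs ε) (parity-xor αs βs ε)
       (parity-xor αs (β ∷ βs) ε)
    where
    open ≡-Reasoning
    a = parity αs ε
    b = parity βs ε
    h = [ α ≈? ε ]
    k = [ β ≈? ε ]

    by : ∀ {γs δs ηs} (t : Tri (α < β) (α ≈ β) (β < α)) →
         parity γs ε ≡ (h ⊻ a) ⊻ b → parity δs ε ≡ a ⊻ b → parity ηs ε ≡ a ⊻ (k ⊻ b) →
         parity (byOrder t (β ∷ γs) δs (α ∷ ηs)) ε ≡ (h ⊻ a) ⊻ (k ⊻ b)
    by (tri< _ _ _) p _ _ = trans (cong (k ⊻_) p) (⊻-swap (h ⊻ a) k b)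
    by (tri> _ _ _) _ _ p = trans (cong (h ⊻_) p) (sym (xor-assoc h a (k ⊻ b)))
    by {δs = δs} (tri≈ _ α≈β _) _ p _ = begin
      parity δs ε       ≡⟨ p ⟩
      a ⊻ b             ≡⟨ cong (_⊻ (a ⊻ b)) (xor-same h) ⟨
      (h ⊻ h) ⊻ (a ⊻ b) ≡⟨ xor-assoc h h (a ⊻ b) ⟩
      h ⊻ (h ⊻ (a ⊻ b)) ≡⟨ cong (h ⊻_) (⊻-swap a h b) ⟩
      h ⊻ (a ⊻ (h ⊻ b)) ≡⟨ xor-assoc h a (h ⊻ b) ⟨
      (h ⊻ a) ⊻ (h ⊻ b) ≡⟨ cong (λ k → (h ⊻ a) ⊻ (k ⊻ b)) (≈?-congˡ α≈β ε) ⟩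
      (h ⊻ a) ⊻ (k ⊻ b) ∎

  -- The bound ε is what keeps the exponent emitted by one step of xor above those
  -- emitted later: it becomes the bound of the remaining problem.
  xor-bounded : ∀ αs βs {ε} → Descending (ε ∷ αs) → Descending (ε ∷ βs) →
                Descending (ε ∷ xor αs βs)
  xor-bounded []       βs       l m = m
  xor-bounded (α ∷ αs) []       l m = l
  xor-bounded (α ∷ αs) (β ∷ βs) {ε} l@(p ∷ l′) m@(q ∷ m′) =
    by (compare α β) (λ α<β → xor-bounded (α ∷ αs) βs (α<β ∷ l′) m′)
       (xor-bounded αs βs (drop-second l) (drop-second m))
       (λ β<α → xor-bounded αs (β ∷ βs) l′ (β<α ∷ m′))
    where
    by : ∀ {γs δs ηs} (t : Tri (α < β) (α ≈ β) (β < α)) →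
         (α < β → Descending (β ∷ γs)) → Descending (ε ∷ δs) → (β < α → Descending (α ∷ ηs)) →
         Descending (ε ∷ byOrder t (β ∷ γs) δs (α ∷ ηs))
    by (tri< α<β _ _) r _ _ = q ∷ r α<β
    by (tri≈ _ _ _)   _ r _ = r
    by (tri> _ _ β<α) _ _ r = p ∷ r β<α

  xor-descending : Descending αs → Descending βs → Descending (xor αs βs)
  xor-descending l m = let _ , l′ , m′ = common-bound l m in tail (xor-bounded _ _ l′ m′)

  parity-above : Descending (η ∷ αs) → η ≤ δ → parity αs δ ≡ false
  parity-above {αs = []}     l p = refl
  parity-above {αs = α ∷ αs} (q ∷ l) p = cong₂ _⊻_
    (dec-false em (<⇒≉ (<-≤-trans q p))) (parity-above l (≤-trans (<⇒≤ q) p))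

  parity-head : Descending (α ∷ αs) → parity (α ∷ αs) α ≡ true
  parity-head l = cong₂ _⊻_ (dec-true em ≈-refl) (parity-above l ≤-refl)

  parity-cong : ∀ αs → δ ≈ η → parity αs δ ≡ parity αs η
  parity-cong []       p = refl
  parity-cong (α ∷ αs) p = cong₂ _⊻_
    (does-⇔ (mk⇔ (λ q → ≈-trans q p) (λ q → ≈-trans q (≈-sym p))) em em) (parity-cong αs p)

  -- Comparison at the highest differing digit

  infix 4 _◁_ _≗_

  _≗_ : List Ord → List Ord → Set₁
  αs ≗ βs = ∀ ε → parity αs ε ≡ parity βs ε

  _◁_ : List Ord → List Ord → Set₁
  αs ◁ βs = ∃[ ε ] parity αs ε ≡ false × parity βs ε ≡ true
                 × (∀ {δ} → ε < δ → parity αs δ ≡ parity βs δ)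

  clash : ∀ {b} → b ≡ false → ¬ b ≡ true
  clash refl ()

  ◁-irrefl : ∀ αs βs → αs ≗ βs → ¬ αs ◁ βs
  ◁-irrefl _ _ e (ε , p , q , _) = clash p (trans (e ε) q)

  ◁-asym : ∀ αs βs → αs ◁ βs → ¬ βs ◁ αs
  ◁-asym αs βs (ε , p , q , e) (δ , r , s , e′) with compare ε δ
  ... | tri< ε<δ _ _ = clash (trans (e ε<δ) r) s
  ... | tri≈ _ ε≈δ _ = clash p (trans (parity-cong αs ε≈δ) s)
  ... | tri> _ _ δ<ε = clash p (trans (sym (e′ δ<ε)) q)

  -- Digits and values are compared together: each of the two orders is total and
  -- asymmetric, so one comparison makes them agree.
  data Comparison (αs βs : List Ord) : Set₁ where
    less    : αs ◁ βs → ∑2^ αs < ∑2^ βs → Comparison αs βs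
    equal   : αs ≗ βs → ∑2^ αs ≈ ∑2^ βs → Comparison αs βs
    greater : βs ◁ αs → ∑2^ βs < ∑2^ αs → Comparison αs βs

  ∑2^-cong-∷ : α ≈ β → ∑2^ αs ≤ ∑2^ βs → ∑2^ (α ∷ αs) ≤ ∑2^ (β ∷ βs)
  ∑2^-cong-∷ {αs = αs} (p , _) q =
    ≤-trans (+-monoˡ-≤ (∑2^ αs) (2^-mono-≤ p)) (+-monoʳ-≤ _ q)

  ∑2^-mono-∷ : α ≈ β → ∑2^ αs < ∑2^ βs → ∑2^ (α ∷ αs) < ∑2^ (β ∷ βs)
  ∑2^-mono-∷ {αs = αs} (p , _) q =
    ≤-<-trans (+-monoˡ-≤ (∑2^ αs) (2^-mono-≤ p)) (+-monoʳ-< _ q)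

  -- An expansion with all exponents below β loses at the digit β itself.
  ◁-head : Descending (β ∷ αs) → Descending (β ∷ βs) → αs ◁ β ∷ βs
  ◁-head {β} l m = β , parity-above l ≤-refl , parity-head m ,
    λ β<δ → trans (parity-above l (<⇒≤ β<δ))
                  (sym (cong₂ _⊻_ (dec-false em (<⇒≉ β<δ)) (parity-above m (<⇒≤ β<δ))))

  <-head : Descending (β ∷ αs) → ∑2^ αs < ∑2^ (β ∷ βs)
  <-head {β} {βs = βs} l = <-≤-trans (∑2^<2^ l) (2^≤∑2^ β βs)

  -- The deciding exponent ε is a member of βs, so it lies below β, and
  -- prepending α and β leaves its digits unchanged.
  ◁-∷ : α ≈ β → Descending (β ∷ βs) → αs ◁ βs → α ∷ αs ◁ β ∷ βs
  ◁-∷ {α} {β} e l (ε , p , q , d) =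
    ε , cong₂ _⊻_ (dec-false em α≉ε) p ,
    cong₂ _⊻_ (dec-false em (λ β≈ε → α≉ε (≈-trans e β≈ε))) q ,
    λ r → cong₂ _⊻_ (≈?-congˡ e _) (d r)
    where
    α≉ε : ¬ α ≈ ε
    α≉ε α≈ε = clash (parity-above l (proj₁ (≈-trans (≈-sym e) α≈ε))) q

  compare-expansions : Descending αs → Descending βs → Comparison αs βs
  compare-expansions {[]}     {[]}     l m = equal (λ _ → refl) ≈-refl
  compare-expansions {[]}     {β ∷ βs} l m = less (◁-head [-] m) (<-head {βs = βs} [-])
  compare-expansions {α ∷ αs} {[]}     l m = greater (◁-head [-] l) (<-head {βs = αs} [-])
  compare-expansions {α ∷ αs} {β ∷ βs} l m with compare α β
  ... | tri< p _ _ = less    (◁-head (p ∷ l) m) (<-head {βs = βs} (p ∷ l))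
  ... | tri> _ _ p = greater (◁-head (p ∷ m) l) (<-head {βs = αs} (p ∷ m))
  ... | tri≈ _ p _ with compare-expansions (tail l) (tail m)
  ...   | less    d q = less    (◁-∷ {βs = βs} {αs} p m d) (∑2^-mono-∷ {αs = αs} {βs} p q)
  ...   | greater d q = greater (◁-∷ {βs = αs} {βs} (≈-sym p) l d)
                            (∑2^-mono-∷ {αs = βs} {αs} (≈-sym p) q)
  ...   | equal   d q = equal (λ ε → cong₂ _⊻_ (≈?-congˡ p ε) (d ε))
                              (∑2^-cong-∷ {αs = αs} {βs} p (proj₁ q) ,
                               ∑2^-cong-∷ {αs = βs} {αs} (≈-sym p) (proj₂ q))

  -- Digits of ordinals and of Nim sums

  bit : Ord → Ord → Bool
  bit α = parity (exponents α)

  exponents-descending : ∀ α → Descending (exponents α)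
  exponents-descending α = proj₁ (proj₂ (expansion α))

  ≈∑2^exponents : ∀ α → α ≈ ∑2^ (exponents α)
  ≈∑2^exponents α = proj₂ (proj₂ (expansion α))

  -- Uniqueness of base-2 expansions.
  parity-unique : Descending αs → Descending βs → ∑2^ αs ≈ ∑2^ βs → αs ≗ βs
  parity-unique l m p with compare-expansions l m
  ... | less    _ q = contradiction p (<⇒≉ q)
  ... | equal   e _ = e
  ... | greater _ q = contradiction (≈-sym p) (<⇒≉ q)

  bit-cong : α ≈ β → ∀ ε → bit α ε ≡ bit β ε
  bit-cong {α} {β} p = parity-unique (exponents-descending α) (exponents-descending β)
    (≈-trans (≈-sym (≈∑2^exponents α)) (≈-trans p (≈∑2^exponents β)))

  bit-injective : (∀ ε → bit α ε ≡ bit β ε) → α ≈ β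
  bit-injective {α} {β} e
    with compare-expansions (exponents-descending α) (exponents-descending β)
  ... | less    d _ = contradiction d (◁-irrefl (exponents α) (exponents β) e)
  ... | equal   _ p = ≈-trans (≈∑2^exponents α) (≈-trans p (≈-sym (≈∑2^exponents β)))
  ... | greater d _ = contradiction d (◁-irrefl (exponents β) (exponents α) λ ε → sym (e ε))

  <⇒◁ : α < β → exponents α ◁ exponents β
  <⇒◁ {α} {β} p
    with compare-expansions (exponents-descending α) (exponents-descending β)
  ... | less    d _ = d
  ... | equal   _ q = contradiction
    (≈-trans (≈∑2^exponents α) (≈-trans q (≈-sym (≈∑2^exponents β)))) (<⇒≉ p)
  ... | greater _ q = contradiction (<-trans p (≤-<-trans (proj₁ (≈∑2^exponents β))
    (<-≤-trans q (proj₂ (≈∑2^exponents α))))) <-irrefl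

  ◁⇒< : exponents α ◁ exponents β → α < β
  ◁⇒< {α} {β} d with compare α β
  ... | tri< p _ _ = p
  ... | tri≈ _ p _ = contradiction d (◁-irrefl (exponents α) (exponents β) (bit-cong p))
  ... | tri> _ _ p = contradiction (<⇒◁ p) (◁-asym (exponents α) (exponents β) d)

  bit-⊕ : ∀ α β ε → bit (α ⊕ᵒ β) ε ≡ bit α ε ⊻ bit β ε
  bit-⊕ α β ε = trans
    (parity-unique (exponents-descending (α ⊕ᵒ β))
      (xor-descending (exponents-descending α) (exponents-descending β))
      (≈-sym (≈∑2^exponents (α ⊕ᵒ β))) ε)
    (parity-xor (exponents α) (exponents β) ε)

  ⊕-cong : ∀ {α α′ β β′} → α ≈ α′ → β ≈ β′ → α ⊕ᵒ β ≈ α′ ⊕ᵒ β′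
  ⊕-cong {α} {α′} {β} {β′} p q = bit-injective λ ε → trans (bit-⊕ α β ε)
    (trans (cong₂ _⊻_ (bit-cong p ε) (bit-cong q ε)) (sym (bit-⊕ α′ β′ ε)))

  ⊕-comm : ∀ α β → α ⊕ᵒ β ≈ β ⊕ᵒ α
  ⊕-comm α β = bit-injective λ ε → trans (bit-⊕ α β ε)
    (trans (xor-comm (bit α ε) (bit β ε)) (sym (bit-⊕ β α ε)))

  -- Nim sum with β undoes itself, as exclusive or with a digit does.
  ⊕-involutiveʳ : ∀ α β → (α ⊕ᵒ β) ⊕ᵒ β ≈ α
  ⊕-involutiveʳ α β = bit-injective λ ε → trans (bit-⊕ (α ⊕ᵒ β) β ε)
    (trans (cong (_⊻ bit β ε) (bit-⊕ α β ε)) (⊻-cancelʳ (bit α ε) (bit β ε)))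

  ⊕-cancelʳ : ∀ {α α′} β → α ⊕ᵒ β ≈ α′ ⊕ᵒ β → α ≈ α′
  ⊕-cancelʳ {α} {α′} β p = ≈-trans (≈-sym (⊕-involutiveʳ α β))
    (≈-trans (⊕-cong p ≈-refl) (⊕-involutiveʳ α′ β))

  ⊕-cancelˡ : ∀ {β β′} α → α ⊕ᵒ β ≈ α ⊕ᵒ β′ → β ≈ β′
  ⊕-cancelˡ {β} {β′} α p =
    ⊕-cancelʳ α (≈-trans (⊕-comm β α) (≈-trans p (⊕-comm α β′)))

  -- If η first differs from α ⊕ᵒ β at a digit ε that comes from α, then
  -- η ⊕ᵒ β agrees with α above ε and loses its digit at ε.
  ⊕-lowers : ∀ {α β η} ε → bit η ε ≡ false → bit α ε ≡ true → bit β ε ≡ false →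
           (∀ {δ} → ε < δ → bit η δ ≡ bit α δ ⊻ bit β δ) → η ⊕ᵒ β < α
  ⊕-lowers {α} {β} {η} ε p q r e = ◁⇒< {η ⊕ᵒ β} {α} (ε ,
    trans (bit-⊕ η β ε) (cong₂ _⊻_ p r) , q ,
    λ {δ} ε<δ → trans (bit-⊕ η β δ)
      (trans (cong (_⊻ bit β δ) (e ε<δ)) (⊻-cancelʳ (bit α δ) (bit β δ))))

  -- The highest digit where η differs from α ⊕ᵒ β is set in exactly one of α and
  -- β; that summand is the one to lower.
  <-⊕ : ∀ {α β η} → η < α ⊕ᵒ β → (∃[ α′ ] α′ < α × η ≈ α′ ⊕ᵒ β)
                                 ⊎ (∃[ β′ ] β′ < β × η ≈ α ⊕ᵒ β′)
  <-⊕ {α} {β} {η} η< with <⇒◁ η<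
  ... | ε , p , q , e with bit α ε in a | bit β ε in b | trans (sym q) (bit-⊕ α β ε)
  ...   | true | false | _ = inj₁ (η ⊕ᵒ β ,
    ⊕-lowers {α} {β} ε p a b (λ {δ} r → trans (e r) (bit-⊕ α β δ)) ,
    ≈-sym (⊕-involutiveʳ η β))
  ...   | false | true | _ = inj₂ (η ⊕ᵒ α ,
    ⊕-lowers {β} {α} ε p b a (λ {δ} r → trans (e r)
      (trans (bit-⊕ α β δ) (xor-comm (bit α δ) (bit β δ)))) ,
    ≈-trans (≈-sym (⊕-involutiveʳ η α)) (⊕-comm (η ⊕ᵒ α) α))

  -- Labelled and unlabelled games

  -- The condition for 𝓣 f x to be α, without mentioning mex: an option labelled
  -- by something other than α needs no answer, any other option is answered
  -- by a move to α.
  Settles : Labelling → Hypergame → Ord → Set₁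
  Settles f x α =
    (∀ {β} → β < α → ∃[ i ] f (option x i) ↦ β) ×
    (∀ i → (∃[ β ] f (option x i) ↦ β × ¬ β ≈ α) ⊎
           (∃[ j ] f (option (option x i) j) ↦ α))

  𝓣⇒Settles : ∀ f x {α} → 𝓣 f x ↦ α → Settles f x α
  𝓣⇒Settles f x {α} p = let μ≈α , rev = 𝓣⁻ f x p in
    (λ β<α → ∈-labels⁻ f x (<mex⇒∈ _ (<-≤-trans β<α (proj₂ μ≈α)))) ,
    λ i → answer μ≈α rev i (⊥-or-↦ (f (option x i)))
    where
    μ = mex (labels f x)

    answer : μ ≈ α → Reverts f x μ → ∀ i →
             f (option x i) ≡ nothing ⊎ ∃[ β ] f (option x i) ↦ β →
             (∃[ β ] f (option x i) ↦ β × ¬ β ≈ α) ⊎ (∃[ j ] f (option (option x i) j) ↦ α)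
    answer μ≈α rev i (inj₁ e) = let j , q = rev i e in inj₂ (j , ↦-resp-≈ μ≈α q)
    answer μ≈α rev i (inj₂ (β , q)) = inj₁ (β , q , λ β≈α →
      mex-∉ _ (∈-labels⁺ f x i (↦-resp-≈ (≈-trans β≈α (≈-sym μ≈α)) q)))

  -- An option with label α would, not being labelled otherwise, have an option
  -- with the same label α, against consistency of γ₀; so α is the mex.
  Settles⇒γ₀ : ∀ x {α} → Settles γ₀ x α → γ₀ x ↦ α
  Settles⇒γ₀ x {α} (attain , answer) = ↦-resp-≈ (≈-sym α≈μ)
    (𝓣γ₀⊑γ₀ x (𝓣⁺ γ₀ x (Reverts-resp-≈ γ₀ x α≈μ rev)))
    where
    avoid : ¬ α ∈ labels γ₀ x
    avoid p with ∈-labels⁻ γ₀ x p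
    ... | i , q with answer i
    ...   | inj₁ (β , r , β≉α) = β≉α (↦-unique r q)
    ...   | inj₂ (j , r)       = D⇒consistent γ₀-D (option x i) j q r

    α≈μ : α ≈ mex (labels γ₀ x)
    α≈μ = mex-unique (labels γ₀ x) avoid
      λ β<α → let i , q = attain β<α in ∈-labels⁺ γ₀ x i q

    rev : Reverts γ₀ x α
    rev i e with answer i
    ... | inj₁ (_ , q , _) = contradiction e (↦⇒≢⊥ q)
    ... | inj₂ r           = r

  labels-⊆ : ∀ {x y} → x ∼ y → ∀ {α} → α ∈ labels γ₀ x → α ∈ labels γ₀ y
  labels-⊆ {x} {y} x∼y p =
    let i , q = ∈-labels⁻ γ₀ x p
        j , r = proj₁ (∼-options x∼y) i
    in ∈-labels⁺ γ₀ y j (D.respects-∼ γ₀-D r q)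

  +-comm : ∀ x y → x + y ∼ y + x
  +-comm x y = (λ (n , m) p → p ≡ (m , n)) , refl , λ { refl →
    (λ { (inj₁ i) → inj₂ i , refl ; (inj₂ j) → inj₁ j , refl }) ,
    (λ { (inj₁ j) → inj₂ j , refl ; (inj₂ i) → inj₁ i , refl }) }

  -- How 𝓣 fails at a game without label: μ is the only candidate for its label,
  -- and moving to the escape cannot be answered by a move to μ.
  record Stuck (x : Hypergame) (μ : Ord) : Set₁ where
    field
      omitted      : ∀ i → ¬ γ₀ (option x i) ↦ μ
      attained     : ∀ {α} → α < μ → ∃[ i ] γ₀ (option x i) ↦ α
      escape       : Option x
      escape-⊥     : γ₀ (option x escape) ≡ nothing
      irreversible : ∀ j → ¬ γ₀ (option (option x escape) j) ↦ μ

  stuck : ∀ x → γ₀ x ≡ nothing → ∃[ μ ] Stuck x μ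
  stuck x e = mex (labels γ₀ x) , record
    { omitted      = λ i p → mex-∉ (labels γ₀ x) (∈-labels⁺ γ₀ x i p)
    ; attained     = λ α<μ → ∈-labels⁻ γ₀ x (<mex⇒∈ (labels γ₀ x) α<μ)
    ; escape       = proj₁ found
    ; escape-⊥     = proj₁ (proj₂ found)
    ; irreversible = proj₂ (proj₂ found)
    }
    where
    found : ∃[ i ] γ₀ (option x i) ≡ nothing ×
                   (∀ j → ¬ γ₀ (option (option x i) j) ↦ mex (labels γ₀ x))
    found = decidable-stable em λ none →
      ↦⇒≢⊥ (𝓣γ₀⊑γ₀ x (𝓣⁺ γ₀ x λ i e′ → decidable-stable em λ no-reply →
        none (i , e′ , λ j p → no-reply (j , p)))) e

  ↦⇒γ≃ : ∀ x {α} → γ₀ x ↦ α → γ x ≃ ord α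
  ↦⇒γ≃ x p with γ₀ x | p
  ... | just _ | just q = ord q

  ⊥⇒γ≃ : ∀ x {K} → γ₀ x ≡ nothing → labels γ₀ x ≐ K → γ x ≃ ∞[ K ]
  ⊥⇒γ≃ x e p with γ₀ x | e
  ... | nothing | _ = ∞[ p ]

  just⇒↦ : ∀ {m : Maybe Ord} {α} → m ≡ just α → m ↦ α
  just⇒↦ refl = just ≈-refl

  -- Sums of games

  -- The laws of the Nim sum under which γ₀ is a homomorphism.
  module Homomorphic (_∙_ : Ord → Ord → Ord)
           (∙-cong : ∀ {α α′ β β′} → α ≈ α′ → β ≈ β′ → α ∙ β ≈ α′ ∙ β′)
           (∙-cancelˡ : ∀ {β β′} α → α ∙ β ≈ α ∙ β′ → β ≈ β′)
           (∙-cancelʳ : ∀ {α α′} β → α ∙ β ≈ α′ ∙ β → α ≈ α′)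
           (<-∙ : ∀ {α β η} → η < α ∙ β → (∃[ α′ ] α′ < α × η ≈ α′ ∙ β)
                                          ⊎ (∃[ β′ ] β′ < β × η ≈ α ∙ β′))
           where

    -- The answers to a move in one summand are moves in that same summand; by
    -- cancellation, a changed label of one summand changes the label of the sum.
    Settles-+ : ∀ f g x y {α β} → Settles f x α → Settles g y β →
                (∀ x′ {α′} → f x′ ↦ α′ → γ₀ (x′ + y) ↦ α′ ∙ β) →
                (∀ y′ {β′} → g y′ ↦ β′ → γ₀ (x + y′) ↦ α ∙ β′) →
                Settles γ₀ (x + y) (α ∙ β)
    Settles-+ f g x y {α} {β} (attainˣ , answerˣ) (attainʸ , answerʸ) left right =
      attain , answer
      where
      attain : ∀ {η} → η < α ∙ β → ∃[ i ] γ₀ (option (x + y) i) ↦ η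
      attain η< with <-∙ {α} {β} η<
      ... | inj₁ (α′ , α′<α , η≈) = let i , p = attainˣ α′<α in
        inj₁ i , ↦-resp-≈ (≈-sym η≈) (left (option x i) p)
      ... | inj₂ (β′ , β′<β , η≈) = let j , p = attainʸ β′<β in
        inj₂ j , ↦-resp-≈ (≈-sym η≈) (right (option y j) p)

      answer : ∀ i → (∃[ η ] γ₀ (option (x + y) i) ↦ η × ¬ η ≈ α ∙ β) ⊎
                     (∃[ j ] γ₀ (option (option (x + y) i) j) ↦ α ∙ β)
      answer (inj₁ i) with answerˣ i
      ... | inj₁ (α′ , p , α′≉α) = inj₁ (_ , left (option x i) p , λ q → α′≉α (∙-cancelʳ β q))
      ... | inj₂ (k , p)         = inj₂ (inj₁ k , left (option (option x i) k) p)
      answer (inj₂ j) with answerʸ j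
      ... | inj₁ (β′ , p , β′≉β) = inj₁ (_ , right (option y j) p , λ q → β′≉β (∙-cancelˡ α q))
      ... | inj₂ (k , p)         = inj₂ (inj₂ k , right (option (option y j) k) p)

    -- Each move in a summand that matters reaches a label of an earlier stage of
    -- that summand, while the other summand keeps its stage.
    stage⇒γ₀-+ : ∀ δ ε x y {α β} → stage δ x ↦ α → stage ε y ↦ β → γ₀ (x + y) ↦ α ∙ β
    stage⇒γ₀-+ (sup f) (sup g) x y p q =
      let i , p′ = ⨆⁻ (successors f) x p
          j , q′ = ⨆⁻ (successors g) y q
      in Settles⇒γ₀ (x + y) (Settles-+ (stage (f i)) (stage (g j)) x y
           (𝓣⇒Settles (stage (f i)) x p′) (𝓣⇒Settles (stage (g j)) y q′)
           (λ x′ r → stage⇒γ₀-+ (f i) (sup g) x′ y r q)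
           (λ y′ r → stage⇒γ₀-+ (sup f) (g j) x y′ p r))

    γ₀-+ : ∀ x y {α β} → γ₀ x ↦ α → γ₀ y ↦ β → γ₀ (x + y) ↦ α ∙ β
    γ₀-+ x y p q = let δ , p′ = ⨆⁻ stage x p
                       ε , q′ = ⨆⁻ stage y q in stage⇒γ₀-+ δ ε x y p′ q′

    Splits : Labelling → Set₁
    Splits f = ∀ x y {η} → f (x + y) ↦ η →
               ∃[ α ] ∃[ β ] γ₀ x ↦ α × γ₀ y ↦ β × α ∙ β ≈ η

    -- The step of the induction for γ₀-splits, where f is the earlier stage that
    -- justifies the label η of x + y.
    not-stuck : ∀ {f} → Splits f → ∀ x y {η μ} →
                Settles f (x + y) η → γ₀ (x + y) ↦ η → γ₀ x ≡ nothing → ¬ Stuck x μ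
    not-stuck {f} splits x y {η} {μ} (attain , answer) x+y↦η x⊥ st = refute reply
      where
      open Stuck st

      no-x+ : ∀ w {ζ} → ¬ f (x + w) ↦ ζ
      no-x+ w p = let _ , _ , q , _ = splits x w p in ↦⇒≢⊥ q x⊥

      no-x′+ : ∀ i w {β ζ} → γ₀ w ↦ β → ζ ≈ μ ∙ β → ¬ f (option x i + w) ↦ ζ
      no-x′+ i w {β} q ζ≈ p =
        let κ , β′ , x′↦κ , w↦β′ , κ∙β′≈ζ = splits (option x i) w p
            κ∙β≈μ∙β = ≈-trans (∙-cong ≈-refl (↦-unique q w↦β′)) (≈-trans κ∙β′≈ζ ζ≈)
        in omitted i (↦-resp-≈ (∙-cancelʳ β κ∙β≈μ∙β) x′↦κ)

      no-escape+ : ∀ w {ζ} → ¬ f (option x escape + w) ↦ ζ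
      no-escape+ w p = let _ , _ , q , _ = splits (option x escape) w p in ↦⇒≢⊥ q escape-⊥

      -- The answer to moving from x to its escape stays in x: the escape has no
      -- label, so neither has its sum with any game.
      reply : ∃[ k ] f (option (option x escape) k + y) ↦ η
      reply with answer (inj₁ escape)
      ... | inj₁ (_ , p , _)  = contradiction p (no-escape+ y)
      ... | inj₂ (inj₁ k , p) = k , p
      ... | inj₂ (inj₂ j , p) = contradiction p (no-escape+ (option y j))

      -- An option of x labelled α would give x + y an option with its own label.
      not-smaller : ∀ {α β} → γ₀ y ↦ β → α ∙ β ≈ η → ¬ α < μ
      not-smaller y↦β ≈η α<μ = let k , p = attained α<μ in
        D⇒consistent γ₀-D (x + y) (inj₁ k) x+y↦η
          (↦-resp-≈ ≈η (γ₀-+ (option x k) y p y↦β))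

      -- Whether μ ∙ β is below or above η, an option of x labelled μ is forced: as
      -- a smaller value that x + y has to attain, or as the answer to a move from y
      -- to an option labelled β′ with μ ∙ β′ ≈ η.
      not-larger : ∀ {α β} → γ₀ y ↦ β → α ∙ β ≈ η → ¬ μ < α
      not-larger {α} {β} y↦β ≈η μ<α = by (compare (μ ∙ β) η)
        where
        at-option : ∃[ i ] f (option (x + y) i) ↦ μ ∙ β → ⊥
        at-option (inj₁ k , p) = no-x′+ k y y↦β ≈-refl p
        at-option (inj₂ j , p) = no-x+ (option y j) p

        lowered : ∀ {β′} → η ≈ μ ∙ β′ → ∃[ j ] γ₀ (option y j) ↦ β′ → ⊥
        lowered η≈ (j , y′↦β′) with answer (inj₂ j)
        ... | inj₁ (_ , p , _)  = no-x+ (option y j) p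
        ... | inj₂ (inj₁ k , p) = no-x′+ k (option y j) y′↦β′ η≈ p
        ... | inj₂ (inj₂ l , p) = no-x+ (option (option y j) l) p

        below-μ∙β : (∃[ α′ ] α′ < μ × η ≈ α′ ∙ β) ⊎ (∃[ β′ ] β′ < β × η ≈ μ ∙ β′) → ⊥
        below-μ∙β (inj₁ (α′ , α′<μ , η≈)) =
          <⇒≉ (<-trans α′<μ μ<α) (∙-cancelʳ β (≈-sym (≈-trans ≈η η≈)))
        below-μ∙β (inj₂ (β′ , β′<β , η≈)) =
          lowered η≈ (proj₁ (𝓣⇒Settles γ₀ y (D⇒⊑𝓣 γ₀-D y y↦β)) β′<β)

        by : Tri (μ ∙ β < η) (μ ∙ β ≈ η) (η < μ ∙ β) → ⊥
        by (tri< μ∙β<η _ _) = at-option (attain μ∙β<η)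
        by (tri≈ _ μ∙β≈η _) = <⇒≉ μ<α (∙-cancelʳ β (≈-trans μ∙β≈η (≈-sym ≈η)))
        by (tri> _ _ η<μ∙β) = below-μ∙β (<-∙ η<μ∙β)

      refute : ¬ (∃[ k ] f (option (option x escape) k + y) ↦ η)
      refute (k , p) =
        let α , β , x″↦α , y↦β , ≈η = splits (option (option x escape) k) y p
        in by x″↦α y↦β ≈η (compare α μ)
        where
        by : ∀ {α β} → γ₀ (option (option x escape) k) ↦ α → γ₀ y ↦ β → α ∙ β ≈ η →
             Tri (α < μ) (α ≈ μ) (μ < α) → ⊥
        by _    y↦β ≈η (tri< α<μ _ _) = not-smaller y↦β ≈η α<μ
        by x″↦α _   _  (tri≈ _ α≈μ _) = irreversible k (↦-resp-≈ α≈μ x″↦α)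
        by _    y↦β ≈η (tri> _ _ μ<α) = not-larger y↦β ≈η μ<α

    -- The case of y without label is that of x by commutativity, since 𝓣 preserves
    -- invariance under bisimilarity.
    stage-splits : ∀ δ → Splits (stage δ)
    stage-splits (sup f) x y {η} p with ⨆⁻ (successors f) (x + y) p
    ... | i , q = conclude (⊥-or-↦ (γ₀ x)) (⊥-or-↦ (γ₀ y))
      where
      s = stage (f i)

      defined : ∀ x y → 𝓣 s (x + y) ↦ η → ¬ γ₀ x ≡ nothing
      defined x y q e = not-stuck {f = s} (stage-splits (f i)) x y (𝓣⇒Settles s (x + y) q)
        (𝓣γ₀⊑γ₀ (x + y) (𝓣-mono (stage⊑γ₀ (f i)) γ₀-D (x + y) q)) e (proj₂ (stuck x e))

      conclude : γ₀ x ≡ nothing ⊎ ∃[ α ] γ₀ x ↦ α → γ₀ y ≡ nothing ⊎ ∃[ β ] γ₀ y ↦ β →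
                 ∃[ α ] ∃[ β ] γ₀ x ↦ α × γ₀ y ↦ β × α ∙ β ≈ η
      conclude (inj₁ e) _ = contradiction e (defined x y q)
      conclude _ (inj₁ e) = contradiction e (defined y x
        (D.respects-∼ (𝓣-D (stage-D (f i))) (+-comm x y) q))
      conclude (inj₂ (α , r)) (inj₂ (β , t)) = α , β , r , t ,
        ↦-unique (γ₀-+ x y r t) (stage⊑γ₀ (sup f) (x + y) p)

    γ₀-splits : Splits γ₀
    γ₀-splits x y p = let δ , q = ⨆⁻ stage (x + y) p in stage-splits δ x y q

    translate : OrdSet → Ord → OrdSet
    translate K α = range (λ k → elem K k ∙ α)

    ∈-translate⁻ : ∀ K {α η} → η ∈ translate K α → ∃[ κ ] κ ∈ K × κ ∙ α ≈ η
    ∈-translate⁻ K (k , p) = elem K k , (k , ≈-refl) , p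

    ∈-translate⁺ : ∀ K {α κ} → κ ∈ K → κ ∙ α ∈ translate K α
    ∈-translate⁺ K (k , p) = k , ∙-cong p ≈-refl

    -- Moving in y keeps x, so only the moves in x lead to labelled games.
    labels-⊥+ord : ∀ x y {β} → γ₀ x ≡ nothing → γ₀ y ↦ β →
                   labels γ₀ (x + y) ≐ translate (labels γ₀ x) β
    labels-⊥+ord x y {β} e q η = mk⇔ to from
      where
      to : η ∈ labels γ₀ (x + y) → η ∈ translate (labels γ₀ x) β
      to p with ∈-labels⁻ γ₀ (x + y) p
      ... | inj₁ i , r = let α , β′ , s , t , ≈η = γ₀-splits (option x i) y r in
        ∈-resp-≈ (translate (labels γ₀ x) β) (≈-trans (∙-cong ≈-refl (↦-unique q t)) ≈η)
          (∈-translate⁺ (labels γ₀ x) (∈-labels⁺ γ₀ x i s))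
      ... | inj₂ j , r = let _ , _ , s , _ = γ₀-splits x (option y j) r in
        contradiction e (↦⇒≢⊥ s)

      from : η ∈ translate (labels γ₀ x) β → η ∈ labels γ₀ (x + y)
      from p with ∈-translate⁻ (labels γ₀ x) p
      ... | κ , κ∈ , ≈η = let i , r = ∈-labels⁻ γ₀ x κ∈ in
        ∈-labels⁺ γ₀ (x + y) (inj₁ i) (↦-resp-≈ ≈η (γ₀-+ (option x i) y r q))

    labels-ord+⊥ : ∀ x y {α} → γ₀ x ↦ α → γ₀ y ≡ nothing →
                   labels γ₀ (x + y) ≐ translate (labels γ₀ y) α
    labels-ord+⊥ x y p e η = mk⇔
      (λ r → Equivalence.to (labels-⊥+ord y x e p η) (labels-⊆ (+-comm x y) r))
      (λ r → labels-⊆ (+-comm y x) (Equivalence.from (labels-⊥+ord y x e p η) r))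

    labels-⊥+⊥ : ∀ x y → γ₀ x ≡ nothing → γ₀ y ≡ nothing → labels γ₀ (x + y) ≐ ∅
    labels-⊥+⊥ x y e e′ η = mk⇔ to λ ()
      where
      to : η ∈ labels γ₀ (x + y) → η ∈ ∅
      to p with ∈-labels⁻ γ₀ (x + y) p
      ... | inj₁ i , r = let _ , _ , _ , s , _ = γ₀-splits (option x i) y r in
        contradiction e′ (↦⇒≢⊥ s)
      ... | inj₂ j , r = let _ , _ , s , _ = γ₀-splits x (option y j) r in
        contradiction e (↦⇒≢⊥ s)

    ⊥⇒+⊥ : ∀ x y → γ₀ x ≡ nothing ⊎ γ₀ y ≡ nothing → γ₀ (x + y) ≡ nothing
    ⊥⇒+⊥ x y e with ⊥-or-↦ (γ₀ (x + y))
    ... | inj₁ n       = n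
    ... | inj₂ (_ , p) = let _ , _ , q , r , _ = γ₀-splits x y p in
      contradiction e [ ↦⇒≢⊥ q , ↦⇒≢⊥ r ]

  open Homomorphic _⊕ᵒ_ ⊕-cong ⊕-cancelˡ ⊕-cancelʳ <-⊕

  -- Unfolding γ x and γ y lets their Nim sum compute once γ₀ x and γ₀ y are known.
  γ-+ : ∀ x y → γ (x + y) ≃ γ x ⊕ γ y
  γ-+ x y = by (γ₀ x) (γ₀ y) refl refl
    where
    by : ∀ m n → γ₀ x ≡ m → γ₀ y ≡ n →
         γ (x + y) ≃ maybe′ ord ∞[ labels γ₀ x ] m ⊕ maybe′ ord ∞[ labels γ₀ y ] n
    by (just α) (just β) e e′ = ↦⇒γ≃ (x + y) (γ₀-+ x y (just⇒↦ e) (just⇒↦ e′))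
    by (just α) nothing  e e′ =
      ⊥⇒γ≃ (x + y) (⊥⇒+⊥ x y (inj₂ e′)) (labels-ord+⊥ x y (just⇒↦ e) e′)
    by nothing  (just β) e e′ =
      ⊥⇒γ≃ (x + y) (⊥⇒+⊥ x y (inj₁ e)) (labels-⊥+ord x y e (just⇒↦ e′))
    by nothing  nothing  e e′ = ⊥⇒γ≃ (x + y) (⊥⇒+⊥ x y (inj₁ e)) (labels-⊥+⊥ x y e e′)

proposition5p24 :
    (em : ∀ {ℓ} → ExcludedMiddle ℓ) → let open Classical em in
    (x y : Hypergame) → γ (x + y) ≃ γ x ⊕ γ y
proposition5p24 em = Summation.γ-+ em
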